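{- Let $n\ge 3$ be an integer. A positive integer $m$ is the sum of three $n$-gonal numbers of positive rank (that is, $m=p^{n}_{a}+p^{n}_{b}+p^{n}_{c}$ for some integers $a,b,c\ge 1$) if and only if there is a vertex $v_{ij}$ ($i,j\ge 0$) lying in a non-trivial component of the graph $\Gamma_{p^{n}_{k}}$ such that $m$ represents $v_{ij}$ in $\mathscr{R}_{n}$, i.e. $m=3+(n-2)i+(n-1)j$.
   Context: For $n\ge 3$ the $k$-th $n$-gonal number (polygonal number of rank $k$) is $p^{n}_{k}=\frac12[(n-2)k^{2}-(n-4)k]$. In particular $p^{3}_{k}=\frac{k(k+1)}{2}$, with $p^{3}_{0}=p^{3}_{ -1}=0$. The points are symbols $v_{ij}$ indexed by pairs of integers $i,j\ge 0$ (as a poset $\mathscr{R}$, the points with fixed $j$ form the infinite chain $v_{0j}<v_{1j}<v_{2j}<\cdots$, and different chains are incomparable). In the representation $\mathscr{R}_{n}$ the point $v_{ij}$ is represented by the number $n_{ij}=3+(n-2)i+(n-1)j$. The graph $\Gamma_{p^{n}_{k}}$ has vertex set $\{v_{ij}: i,j\ge 0\}$, and its arrows are exactly those joining consecutive vertices of the following paths (where $v_{(x)(y)}$ denotes the vertex with first index $x$ and second index $y$): (1) the left boundary path, whose vertices in order are $v_{(p^{3}_{i-1})(i)}$, $i=0,1,2,\dots$; (2) for all integers $i_{0},j\ge 0$, the path $P$ whose vertices in order are $v_{(p^{3}_{i_{0}-1}+p^{3}_{k-1})(i_{0}+k)}$, $k=0,1,\dots,j$; (3) for all integers $i_{0},j\ge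 0$, the path $P'$ whose vertices in order are $v_{(p^{3}_{i_{0}-1}+p^{3}_{j-1}+p^{3}_{l-1})(i_{0}+j+l)}$, $l=0,1,\dots,j$. A component of the graph means a connected component of the underlying undirected graph; it is non-trivial if it contains at least one arrow (i.e. it is not a single isolated vertex). -}

module Defs where

open import Data.Nat.Base as ℕ using (ℕ; suc)
open import Data.Integer.Base using (ℤ; +_; _+_; _-_; _*_; _≥_; _/ℕ_; ∣_∣)
open import Data.Product.Base using (∃-syntax; _×_)
open import Level using (0ℓ)
open import Relation.Binary.Core using (Rel)
open import Relation.Binary.Construct.Closure.Equivalence using (EqClosure)
open import Relation.Binary.PropositionalEquality.Core using (_≡_)
open import Relation.Unary using (Pred; _∈_)

-- The division is exact: the numerator equals (n - 2) k (k - 1) + 2 k.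
polygonal : ℕ → ℤ → ℤ
polygonal n k = ((+ n - + 2) * (k * k) - (+ n - + 4) * k) /ℕ 2

-- Nothing is lost by ∣_∣: k (k + 1) / 2 is nonnegative for every integer k.
-- The argument is an integer because rank -1 occurs below.
p³ : ℤ → ℕ
p³ k = ∣ polygonal 3 k ∣

SumOfThreePolygonal : ℕ → ℕ → Set
SumOfThreePolygonal n m =
  ∃[ a ] ∃[ b ] ∃[ c ]
    a ≥ + 1 × b ≥ + 1 × c ≥ + 1 ×
    + m ≡ polygonal n a + polygonal n b + polygonal n c

record Vertex : Set where
  constructor v
  field
    i j : ℕ

-- The truncated subtractions are genuine ones for n ≥ 2.
represent : ℕ → Vertex → ℕ
represent n (v i j) = 3 ℕ.+ (n ℕ.∸ 2) ℕ.* i ℕ.+ (n ℕ.∸ 1) ℕ.* j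

boundaryPath : ℕ → Vertex
boundaryPath i = v (p³ (+ i - + 1)) i

path : (i₀ k : ℕ) → Vertex
path i₀ k = v (p³ (+ i₀ - + 1) ℕ.+ p³ (+ k - + 1)) (i₀ ℕ.+ k)

path′ : (i₀ j l : ℕ) → Vertex
path′ i₀ j l =
  v (p³ (+ i₀ - + 1) ℕ.+ p³ (+ j - + 1) ℕ.+ p³ (+ l - + 1)) (i₀ ℕ.+ j ℕ.+ l)

-- The second and third families of paths have vertices with k, l = 0, …, j,
-- so their arrows start at k, l < j.  The graph does not depend on n.
data Arrow : Rel Vertex 0ℓ where
  boundary : ∀ i → Arrow (boundaryPath i) (boundaryPath (suc i))
  onPath   : ∀ i₀ j k → k ℕ.< j → Arrow (path i₀ k) (path i₀ (suc k))
  onPath′  : ∀ i₀ j l → l ℕ.< j → Arrow (path′ i₀ j l) (path′ i₀ j (suc l))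

Component : Vertex → Pred Vertex 0ℓ
Component x y = EqClosure Arrow x y

NonTrivial : Pred Vertex 0ℓ → Set
NonTrivial C = ∃[ x ] ∃[ y ] x ∈ C × y ∈ C × Arrow x y

{-# OPTIONS --safe #-}
-- Put T x = x (x - 1) / 2 = p³ (x - 1).  Then p n (x + 1) = 1 + (n - 2) T x + (n - 1) x,
-- so the sum of the n-gonal numbers of ranks x + 1, y + 1, z + 1 is represented at the
-- vertex with indices T x + T y + T z and x + y + z, and it remains to see that the
-- vertices of this form are exactly the endpoints of arrows.
module Submission where

open import Defs
open import Data.Nat.Base as ℕ using (ℕ; zero; suc; _≤_; s≤s)
import Data.Nat.DivMod as ℕ
import Data.Nat.Properties as ℕ
import Data.Nat.Tactic.RingSolver as ℕ-Solver
open import Data.Integer.Base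
  using (+_; _+_; _-_; _*_; _/ℕ_; ∣_∣; +≤+)
open import Data.Integer.Properties using (pos-*; +-injective)
import Data.Integer.Tactic.RingSolver as ℤ-Solver
open import Data.Product.Base using (∃-syntax; _×_; _,_)
open import Function.Bundles using (_⇔_; mk⇔)
open import Relation.Binary.Construct.Closure.ReflexiveTransitive using (ε; _◅_)
open import Relation.Binary.Construct.Closure.Symmetric using (fwd; bwd)
open import Relation.Binary.Definitions using (tri<; tri≈; tri>)
open import Relation.Binary.PropositionalEquality

-- This is T, with values 0, 0, 1, 3, 6; the recursion avoids both the division and the rank -1.
triangular : ℕ → ℕ
triangular zero    = 0
triangular (suc x) = x ℕ.+ triangular x

-- This is x (x - 1) = 2 T x with the subtraction moved across, so that it lives in ℕ.
square≡x+2triangular : ∀ x → x ℕ.* x ≡ x ℕ.+ triangular x ℕ.* 2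
square≡x+2triangular zero    = refl
square≡x+2triangular (suc x) = begin
  suc x ℕ.* suc x                         ≡⟨ expand x ⟩
  1 ℕ.+ 2 ℕ.* x ℕ.+ x ℕ.* x               ≡⟨ cong (1 ℕ.+ 2 ℕ.* x ℕ.+_) (square≡x+2triangular x) ⟩
  1 ℕ.+ 2 ℕ.* x ℕ.+ (x ℕ.+ triangular x ℕ.* 2)  ≡⟨ collect x (triangular x) ⟩
  suc x ℕ.+ (x ℕ.+ triangular x) ℕ.* 2    ∎
  where
  open ≡-Reasoning
  expand : ∀ x → suc x ℕ.* suc x ≡ 1 ℕ.+ 2 ℕ.* x ℕ.+ x ℕ.* x
  expand = ℕ-Solver.solve-∀
  collect : ∀ x t → 1 ℕ.+ 2 ℕ.* x ℕ.+ (x ℕ.+ t ℕ.* 2) ≡ suc x ℕ.+ (x ℕ.+ t) ℕ.* 2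
  collect = ℕ-Solver.solve-∀

-- Replacing x * x by x + 2 T x turns the numerator into twice k T x + x, so the division by 2 is
-- exact.
polygonal-+ : ∀ k x → polygonal (2 ℕ.+ k) (+ x) ≡ + (k ℕ.* triangular x ℕ.+ x)
polygonal-+ k x = begin
  polygonal (2 ℕ.+ k) (+ x)  ≡⟨ cong (_/ℕ 2) numerator ⟩
  + (q ℕ.* 2) /ℕ 2           ≡⟨ cong +_ (ℕ.m*n/n≡m q 2) ⟩
  + q                        ∎
  where
  open ≡-Reasoning
  t q : ℕ
  t = triangular x
  q = k ℕ.* t ℕ.+ x

  square : + x * + x ≡ + x + + t * + 2
  square = begin
    + x * + x            ≡⟨ pos-* x x ⟨
    + (x ℕ.* x)          ≡⟨ cong +_ (square≡x+2triangular x) ⟩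
    + (x ℕ.+ t ℕ.* 2)    ≡⟨ cong (_+_ (+ x)) (pos-* t 2) ⟩
    + x + + t * + 2      ∎

  simplify : ∀ K X T → (+ 2 + K - + 2) * (X + T * + 2) - (+ 2 + K - + 4) * X
                       ≡ (K * T + X) * + 2
  simplify = ℤ-Solver.solve-∀

  numerator : (+ (2 ℕ.+ k) - + 2) * (+ x * + x) - (+ (2 ℕ.+ k) - + 4) * + x ≡ + (q ℕ.* 2)
  numerator = begin
    (+ 2 + + k - + 2) * (+ x * + x) - (+ 2 + + k - + 4) * + x
      ≡⟨ cong (λ s → (+ 2 + + k - + 2) * s - (+ 2 + + k - + 4) * + x) square ⟩
    (+ 2 + + k - + 2) * (+ x + + t * + 2) - (+ 2 + + k - + 4) * + x
      ≡⟨ simplify (+ k) (+ x) (+ t) ⟩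
    (+ k * + t + + x) * + 2
      ≡⟨ cong (λ s → (s + + x) * + 2) (pos-* k t) ⟨
    + q * + 2
      ≡⟨ pos-* q 2 ⟨
    + (q ℕ.* 2) ∎

-- Only x = 0 reaches rank -1, where evaluation gives 0; otherwise the rank is natural and
-- `polygonal-+` applies with k = 1.
p³-pred : ∀ x → p³ (+ x - + 1) ≡ triangular x
p³-pred zero    = refl
p³-pred (suc x) = begin
  p³ (+ x)                      ≡⟨ cong ∣_∣ (polygonal-+ 1 x) ⟩
  1 ℕ.* triangular x ℕ.+ x      ≡⟨ ℕ.+-comm (1 ℕ.* triangular x) x ⟩
  x ℕ.+ 1 ℕ.* triangular x      ≡⟨ cong (x ℕ.+_) (ℕ.*-identityˡ (triangular x)) ⟩
  x ℕ.+ triangular x            ∎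
  where open ≡-Reasoning

sum-polygonal≡represent : ∀ k x y z →
  polygonal (2 ℕ.+ k) (+ suc x) + polygonal (2 ℕ.+ k) (+ suc y) + polygonal (2 ℕ.+ k) (+ suc z)
    ≡ + represent (2 ℕ.+ k) (path′ x y z)
sum-polygonal≡represent k x y z
  rewrite polygonal-+ k (suc x) | polygonal-+ k (suc y) | polygonal-+ k (suc z)
        | p³-pred x | p³-pred y | p³-pred z
  -- Since `triangular (suc x)` unfolds to x + T x, each summand regroups as 1 + k T x + (1 + k) x.
  = cong +_ (regroup k x y z (triangular x) (triangular y) (triangular z))
  where
  regroup : ∀ k x y z tx ty tz →
    (k ℕ.* (x ℕ.+ tx) ℕ.+ suc x) ℕ.+ (k ℕ.* (y ℕ.+ ty) ℕ.+ suc y) ℕ.+ (k ℕ.* (z ℕ.+ tz) ℕ.+ suc z)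
      ≡ 3 ℕ.+ k ℕ.* (tx ℕ.+ ty ℕ.+ tz) ℕ.+ (1 ℕ.+ k) ℕ.* (x ℕ.+ y ℕ.+ z)
  regroup = ℕ-Solver.solve-∀

-- Arrows of P′ start only at l < j; this symmetry lets the larger of the last two parameters act as
-- j.
path′-swap : ∀ x y z → path′ x y z ≡ path′ x z y
path′-swap x y z = cong₂ v
  (swap (p³ (+ x - + 1)) (p³ (+ y - + 1)) (p³ (+ z - + 1)))
  (swap x y z)
  where
  swap : ∀ a b c → a ℕ.+ b ℕ.+ c ≡ a ℕ.+ c ℕ.+ b
  swap = ℕ-Solver.solve-∀

-- A zero parameter contributes p³ (-1) = 0, so P and the boundary path visit only vertices of the
-- form `path′`.
path≡path′ : ∀ i k → path i k ≡ path′ i k 0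
path≡path′ i k = sym (cong₂ v (ℕ.+-identityʳ _) (ℕ.+-identityʳ _))

boundaryPath≡path′ : ∀ i → boundaryPath i ≡ path′ i 0 0
boundaryPath≡path′ i =
  trans (sym (cong₂ v (ℕ.+-identityʳ _) (ℕ.+-identityʳ _))) (path≡path′ i 0)

source-nonTrivial : ∀ {x y} → Arrow x y → NonTrivial (Component x)
source-nonTrivial a = _ , _ , ε , fwd a ◅ ε , a

target-nonTrivial : ∀ {x y} → Arrow x y → NonTrivial (Component y)
target-nonTrivial a = _ , _ , bwd a ◅ ε , ε , a

path′-nonTrivial : ∀ x y z → NonTrivial (Component (path′ x y z))
path′-nonTrivial x y z with ℕ.<-cmp z y
... | tri< z<y _ _ = source-nonTrivial (onPath′ x y z z<y)
... | tri> _ _ y<z =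
  subst (λ u → NonTrivial (Component u)) (path′-swap x z y)
    (source-nonTrivial (onPath′ x z y y<z))
-- For j = 0 the path P′ is a single vertex without arrows, so the arrow comes from the boundary
-- path.
path′-nonTrivial x zero .zero | tri≈ _ refl _ =
  subst (λ u → NonTrivial (Component u)) (boundaryPath≡path′ x)
    (source-nonTrivial (boundary x))
-- For l = j > 0 the vertex ends P′, hence is the target of its last arrow.
path′-nonTrivial x (suc y) .(suc y) | tri≈ _ refl _ =
  target-nonTrivial (onPath′ x (suc y) y (ℕ.n<1+n y))

IsPath′Vertex : Vertex → Set
IsPath′Vertex u = ∃[ x ] ∃[ y ] ∃[ z ] u ≡ path′ x y z

source-path′ : ∀ {u w} → Arrow u w → IsPath′Vertex u
source-path′ (boundary i)      = i , 0 , 0 , boundaryPath≡path′ i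
source-path′ (onPath i k l _)  = i , l , 0 , path≡path′ i l
source-path′ (onPath′ i j l _) = i , j , l , refl

target-path′ : ∀ {u w} → Arrow u w → IsPath′Vertex w
target-path′ (boundary i)      = suc i , 0 , 0 , boundaryPath≡path′ (suc i)
target-path′ (onPath i k l _)  = i , suc l , 0 , path≡path′ i (suc l)
target-path′ (onPath′ i j l _) = i , j , suc l , refl

-- Only the first step of the zigzag from u to the source of the given arrow matters: it is an arrow
-- touching u, and if the zigzag is empty, u is that source itself.
nonTrivial-path′ : ∀ {u} → NonTrivial (Component u) → IsPath′Vertex u
nonTrivial-path′ (_ , _ , ε         , _ , a) = source-path′ a
nonTrivial-path′ (_ , _ , fwd a ◅ _ , _ , _) = source-path′ a
nonTrivial-path′ (_ , _ , bwd a ◅ _ , _ , _) = target-path′ a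

theorem11 : ∀ (n : ℕ) → 3 ≤ n → ∀ (m : ℕ) → 1 ≤ m →
    SumOfThreePolygonal n m ⇔
    (∃[ x ] NonTrivial (Component x) × m ≡ represent n x)
-- Writing n = 2 + k makes the truncated n - 2 and n - 1 compute to k and 1 + k.
theorem11 (suc (suc k)) _ m _ = mk⇔ to from
  where
  to : SumOfThreePolygonal (2 ℕ.+ k) m →
       ∃[ x ] NonTrivial (Component x) × m ≡ represent (2 ℕ.+ k) x
  to (+ suc x , + suc y , + suc z , _ , _ , _ , m≡) =
    path′ x y z , path′-nonTrivial x y z ,
    +-injective (trans m≡ (sum-polygonal≡represent k x y z))
  to (+ zero , _ , _ , +≤+ () , _)
  to (+ suc _ , + zero , _ , _ , +≤+ () , _)
  to (+ suc _ , + suc _ , + zero , _ , _ , +≤+ () , _)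

  from : ∃[ x ] NonTrivial (Component x) × m ≡ represent (2 ℕ.+ k) x →
         SumOfThreePolygonal (2 ℕ.+ k) m
  from (_ , nt , refl) with nonTrivial-path′ nt
  ... | x , y , z , refl =
    + suc x , + suc y , + suc z ,
    +≤+ (s≤s ℕ.z≤n) , +≤+ (s≤s ℕ.z≤n) , +≤+ (s≤s ℕ.z≤n) ,
    sym (sum-polygonal≡represent k x y z)
theorem11 (suc zero) (s≤s ())
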